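{- Let $n,m\ge 1$, let $g_1,\ldots,g_m$ be computable functions from $\mathbb{Z}^{n+1}$ to $\mathbb{Z}^n$, and let $PROG=(S,I,R)$ be the while-loop program with variables $x[1],\ldots,x[n]$ determined by $g_1,\ldots,g_m$. Let $C_1,C_2,\ldots,C_m$ be the $n\times n$ matrices, with entries in $\mathbb{Z}\cup\{\infty\}$, associated to the cases $\mathrm{control}=1,\ldots,\mathrm{control}=m$. If every (finite, nonempty, repetitions allowed) product of the $C_i$'s is a matrix with a negative integer on the diagonal, then the program terminates, i.e., every computation of $PROG$ is finite.
   Context: The while-loop program determined by $g_1,\ldots,g_m:\mathbb{Z}^{n+1}\to\mathbb{Z}^n$ is the following. The state is $X=(x[1],\ldots,x[n])\in\mathbb{Z}^n$; initially $X$ is an arbitrary element of $\mathbb{Z}^n$ supplied by the user. While $x[1]>0$ and $x[2]>0$ and $\cdots$ and $x[n]>0$, the user chooses $\mathrm{control}=i\in\{1,\ldots,m\}$ and an integer $u\in\mathbb{Z}$, and $X$ is replaced by $g_i(X,u)$. Formally $S=I=\mathbb{Z}^n$, and $R(s,t)$ holds iff all coordinates of $s$ are positive and there exist $i\in\{1,\ldots,m\}$ and $u\in\mathbb{Z}$ with $t=g_i(s,u)$. A computation is a finite or infinite sequence of states $s_1,s_2,\ldots$ with $s_1\in I$, with $R(s_i,s_{i+1})$ for all consecutive terms, and such that if the sequence is finite with last state $s$ then there is no $t$ with $R(s,t)$. The matrix $C_\ell$ associated to $\mathrm{control}=\ell$ records what is known about one execution of that case: its $(i,j)$ entry is the difference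 (new value of $x[j]$) minus (old value of $x[i]$) if this difference is known, and $\infty$ if it is not known. That is, each entry $C_\ell[i,j]$ is either $\infty$, or an integer $d$ such that for every state $X$ satisfying the loop condition and every $u\in\mathbb{Z}$, the $j$-th coordinate of $g_\ell(X,u)$ equals $x[i]+d$. The product of two $n\times n$ matrices $A=(a_{ij})$, $B=(b_{ij})$ over $\mathbb{Z}\cup\{\infty\}$ is the nonstandard (min-plus) product $AB[i,j]=\min_{1\le k\le n}\{a_{ik}+b_{kj}\}$, where $\infty+x=x+\infty=\infty$ for all $x\in\mathbb{Z}\cup\{\infty\}$. -}

module Defs where

open import Data.Fin.Base using (Fin)
open import Data.Integer.Base using (ℤ; +_; -[1+_]; 0ℤ; _+_; _⊓_; _<_)
open import Data.List.NonEmpty.Base as List⁺ using (List⁺)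
open import Data.Maybe.Base using (Maybe; just; nothing)
import Data.Nat.Base as ℕ
open import Data.Nat.Base using (ℕ; suc)
open import Data.Product.Base using (∃-syntax; _×_)
open import Data.Unit.Base using (⊤)
open import Data.Vec.Base using (Vec; []; _∷_; _∷ʳ_; lookup; map)
import Data.Vec.Functional as Vector
open import Data.Vec.Relation.Binary.Pointwise.Inductive using (Pointwise)
open import Level using (0ℓ)
open import Relation.Binary.Core using (Rel)
open import Relation.Binary.PropositionalEquality.Core using (_≡_)
open import Relation.Nullary.Construct.Add.Supremum using (_⁺; [_]) renaming (⊤⁺ to ∞)
open import Relation.Nullary.Negation.Core using (¬_)
open import Relation.Unary using (Pred)

-- Computability of functions between powers of ℤ, via partial recursive
-- functions on ℕ and the bijective coding of ℤ below.

data Rec : ℕ → Set where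
  zer  : Rec 0
  succ : Rec 1
  proj : ∀ {k} → Fin k → Rec k
  comp : ∀ {j k} → Rec j → Vec (Rec k) j → Rec k
  prec : ∀ {k} → Rec k → Rec (2 ℕ.+ k) → Rec (suc k)
  mu   : ∀ {k} → Rec (suc k) → Rec k

infix 4 _⟨_⟩⇓_

-- f ⟨ xs ⟩⇓ y: the partial function f is defined at xs, with value y.
data _⟨_⟩⇓_ : ∀ {k} → Rec k → Vec ℕ k → ℕ → Set where
  zer⇓  : zer ⟨ [] ⟩⇓ 0
  succ⇓ : ∀ {x} → succ ⟨ x ∷ [] ⟩⇓ suc x
  proj⇓ : ∀ {k} {i : Fin k} {xs} → proj i ⟨ xs ⟩⇓ lookup xs i
  comp⇓ : ∀ {j k} {f : Rec j} {gs : Vec (Rec k) j} {xs ys z} →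
          Pointwise (λ g y → g ⟨ xs ⟩⇓ y) gs ys → f ⟨ ys ⟩⇓ z →
          comp f gs ⟨ xs ⟩⇓ z
  prec-zero⇓ : ∀ {k} {f : Rec k} {g xs y} →
          f ⟨ xs ⟩⇓ y → prec f g ⟨ 0 ∷ xs ⟩⇓ y
  prec-suc⇓ : ∀ {k} {f : Rec k} {g xs n y z} →
          prec f g ⟨ n ∷ xs ⟩⇓ y → g ⟨ n ∷ y ∷ xs ⟩⇓ z →
          prec f g ⟨ suc n ∷ xs ⟩⇓ z
  mu⇓   : ∀ {k} {f : Rec (suc k)} {xs y} →
          f ⟨ y ∷ xs ⟩⇓ 0 →
          (∀ x → x ℕ.< y → ∃[ z ] (f ⟨ x ∷ xs ⟩⇓ suc z)) →
          mu f ⟨ xs ⟩⇓ y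

code : ℤ → ℕ
code (+ n)    = 2 ℕ.* n
code -[1+ n ] = suc (2 ℕ.* n)

Computable : ∀ {k n} → (Vec ℤ k → Vec ℤ n) → Set
Computable {k} f =
  ∀ j → ∃[ c ] (∀ (xs : Vec ℤ k) → c ⟨ map code xs ⟩⇓ code (lookup (f xs) j))

record Program : Set₁ where
  field
    S : Set
    I : Pred S 0ℓ
    R : Rel S 0ℓ

-- A finite or infinite sequence of elements of A is a function ℕ → Maybe A
-- that, once it takes the value nothing, remains nothing; it is finite when
-- it reaches nothing.  Indexing starts at 0.

record IsComputation (P : Program) (s : ℕ → Maybe (Program.S P)) : Set where
  open Program P
  field
    closed  : ∀ i → s i ≡ nothing → s (suc i) ≡ nothing
    initial : ∃[ a ] (s 0 ≡ just a × I a)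
    steps   : ∀ i a b → s i ≡ just a → s (suc i) ≡ just b → R a b
    maximal : ∀ i a → s i ≡ just a → s (suc i) ≡ nothing → ¬ (∃[ b ] R a b)

Finite : {A : Set} → (ℕ → Maybe A) → Set
Finite s = ∃[ i ] (s i ≡ nothing)

Terminates : Program → Set
Terminates P = ∀ s → IsComputation P s → Finite s

AllPositive : ∀ {n} → Vec ℤ n → Set
AllPositive X = ∀ i → 0ℤ < lookup X i

-- The argument (X , u) ∈ ℤⁿ⁺¹ of g ℓ is X ∷ʳ u.
whileProgram : ∀ {n m} → (Fin m → Vec ℤ (suc n) → Vec ℤ n) → Program
whileProgram {n} g = record
  { S = Vec ℤ n
  ; I = λ _ → ⊤
  ; R = λ X Y → AllPositive X × ∃[ ℓ ] ∃[ u ] (Y ≡ g ℓ (X ∷ʳ u))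
  }

ℤ∞ : Set
ℤ∞ = ℤ ⁺

infixl 6 _+∞_ _⊓∞_
infixl 7 _⊗_

_+∞_ : ℤ∞ → ℤ∞ → ℤ∞
[ a ] +∞ [ b ] = [ a + b ]
[ a ] +∞ ∞     = ∞
∞     +∞ _     = ∞

_⊓∞_ : ℤ∞ → ℤ∞ → ℤ∞
[ a ] ⊓∞ [ b ] = [ a ⊓ b ]
[ a ] ⊓∞ ∞     = [ a ]
∞     ⊓∞ y     = y

Matrix : ℕ → Set
Matrix n = Fin n → Fin n → ℤ∞

_⊗_ : ∀ {n} → Matrix n → Matrix n → Matrix n
(A ⊗ B) i j = Vector.foldr _⊓∞_ ∞ (λ k → A i k +∞ B k j)

-- ⊗ is associative, so one bracketing per word suffices.
matrixProduct : ∀ {n m} → (Fin m → Matrix n) → List⁺ (Fin m) → Matrix n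
matrixProduct C w = List⁺.foldr₁ _⊗_ (List⁺.map C w)

-- C records known differences (new x[j]) − (old x[i]); ∞ asserts nothing.
Associated : ∀ {n} → (Vec ℤ (suc n) → Vec ℤ n) → Matrix n → Set
Associated g C = ∀ i j d → C i j ≡ [ d ] →
  ∀ X u → AllPositive X → lookup (g (X ∷ʳ u)) j ≡ lookup X i + d

HasNegativeDiagonalEntry : ∀ {n} → Matrix n → Set
HasNegativeDiagonalEntry A = ∃[ i ] ∃[ d ] (A i i ≡ [ d ] × d < 0ℤ)

{-# OPTIONS --safe #-}

-- If a stretch of the computation leads from X to Y by the word w, every finite
-- entry d at (i , j) of the product along w is the exact difference
-- y[j] − x[i].  A negative diagonal entry of the product therefore says that some
-- coordinate of Y is smaller than the same coordinate of X.  Hence an infinite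
-- computation would be a sequence of positive integer vectors with no earlier
-- term dominated by a later one, contradicting Dickson's lemma.
-- Dickson's lemma is proved constructively, through almost-full relations: the
-- intersection of finitely many almost-full relations is almost full.
module Submission where

open import Defs
open import Data.Empty using (⊥-elim)
open import Data.Fin.Base using (Fin; zero; suc)
open import Data.Fin.Properties using (∀-cons)
open import Data.Integer.Base as ℤ using (ℤ; 0ℤ; ∣_∣)
import Data.Integer.Properties as ℤ
open import Data.List.Base using ([]; _∷_)
open import Data.List.NonEmpty.Base using (List⁺; _∷_)
open import Data.Maybe.Base using (Maybe; just; nothing; maybe)
open import Data.Nat.Base using (ℕ; zero; suc; _+_; _≤_; _<_; z≤n; s≤s)
open import Data.Nat.Properties using (≤-refl; ≤-trans; <⇒≱; ≤-<-connex; +-identityʳ; +-suc)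
open import Data.Product.Base using (∃-syntax; _×_; _,_; proj₁)
open import Data.Sum.Base as Sum using (_⊎_; inj₁; inj₂; [_,_]′)
open import Data.Vec.Base using (Vec; lookup)
import Data.Vec.Functional as Vector
open import Function.Base using (_∘_; _on_)
open import Level using (Level; _⊔_)
open import Relation.Binary.Core using (Rel; _⇒_)
open import Relation.Binary.Construct.Intersection using (_∩_)
open import Relation.Binary.Construct.Union using (_∪_)
open import Relation.Binary.PropositionalEquality using (_≡_; refl; sym; trans; cong; subst; subst₂; module ≡-Reasoning)
open import Relation.Nullary.Construct.Add.Supremum using ([_]) renaming (⊤⁺ to ∞)
open import Relation.Unary using (Pred)

private
  variable
    a ℓ : Level
    A B : Set a
    R S : Rel A ℓ

-- Almost-full relations

-- Once `x` has been seen, a pair `y`, `z` of later terms also counts as good when `x` is related to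
-- `y`.
after : Rel A ℓ → A → Rel A ℓ
after R x y z = R y z ⊎ R x y

-- An inductive form of "every infinite sequence has terms x before y with R x y"
-- (Vytiniotis, Coquand and Wahlstedt).
data AlmostFull {A : Set a} (R : Rel A ℓ) : Set (a ⊔ ℓ) where
  now   : (∀ x y → R x y) → AlmostFull R
  later : (∀ x → AlmostFull (after R x)) → AlmostFull R

almostFull-mono : R ⇒ S → AlmostFull R → AlmostFull S
almostFull-mono R⇒S (now r)   = now λ x y → R⇒S (r x y)
almostFull-mono R⇒S (later r) = later λ x → almostFull-mono (Sum.map R⇒S R⇒S) (r x)

almostFull-on : (f : B → A) → AlmostFull R → AlmostFull (R on f)
almostFull-on f (now r)   = now λ x y → r (f x) (f y)
almostFull-on f (later r) = later λ x → almostFull-on f (r (f x))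

⊎-swapʳ : {X Y Z : Set ℓ} → (X ⊎ Y) ⊎ Z → (X ⊎ Z) ⊎ Y
⊎-swapʳ (inj₁ (inj₁ x)) = inj₁ (inj₁ x)
⊎-swapʳ (inj₁ (inj₂ y)) = inj₂ y
⊎-swapʳ (inj₂ z)        = inj₁ (inj₂ z)

-- The three versions of the intersection theorem below differ in the arity of the
-- predicates intersected; each version reduces to the one of smaller arity, since
-- fixing the first point x turns R into the predicate R x of one variable less.
module _ {A : Set a} where

  -- `T` collects the alternatives gained so far; keeping `P` and `Q` arbitrary lets the induction
  -- run on the almost-fullness proofs.
  almostFull-×-const : {P Q T : Rel A ℓ} {U V : Set ℓ} →
    (∀ {x y} → P x y → T x y ⊎ U) → (∀ {x y} → Q x y → T x y ⊎ V) →
    AlmostFull P → AlmostFull Q → AlmostFull (λ x y → T x y ⊎ (U × V))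
  almostFull-×-const f g (now p) q =
    almostFull-mono (λ {x} {y} qxy → [ inj₁ , (λ u → Sum.map₂ (u ,_) (g qxy)) ]′ (f (p x y))) q
  almostFull-×-const {T = T} f g (later p) q = later λ x →
    almostFull-mono
      (λ { (inj₁ (inj₁ t)) → inj₁ (inj₁ t) ; (inj₁ (inj₂ t)) → inj₂ (inj₁ t) ; (inj₂ uv) → inj₁ (inj₂ uv) })
      (almostFull-×-const {T = after T x}
        (λ { (inj₁ r) → Sum.map₁ inj₁ (f r) ; (inj₂ r) → Sum.map₁ inj₂ (f r) })
        (Sum.map₁ inj₁ ∘ g) (p x) q)

  almostFull-×-unary : {P Q T : Rel A ℓ} {U V : Pred A ℓ} →
    (∀ {x y} → P x y → T x y ⊎ U x) → (∀ {x y} → Q x y → T x y ⊎ V x) →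
    AlmostFull P → AlmostFull Q → AlmostFull (λ x y → T x y ⊎ (U x × V x))
  almostFull-×-unary f g (now p) q =
    almostFull-mono (λ {x} {y} qxy → [ inj₁ , (λ u → Sum.map₂ (u ,_) (g qxy)) ]′ (f (p x y))) q
  almostFull-×-unary f g p@(later _) (now q) =
    almostFull-mono (λ {x} {y} pxy → [ inj₁ , (λ v → Sum.map₂ (_, v) (f pxy)) ]′ (g (q x y))) p
  almostFull-×-unary {T = T} {U} {V} f g p@(later p′) q@(later q′) = later λ x →
    almostFull-mono
      (λ { (inj₁ (inj₁ (inj₁ t))) → inj₁ (inj₁ t) ; (inj₁ (inj₁ (inj₂ t))) → inj₂ (inj₁ t)
         ; (inj₁ (inj₂ uv)) → inj₁ (inj₂ uv) ; (inj₂ uv) → inj₂ (inj₂ uv) })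
      -- Advancing only the first proof past `x` leaves the extra alternative `U x`, advancing only
      -- the second leaves `V x`; with `x` fixed both are constants, and combine to `U x × V x`.
      (almostFull-×-const {T = λ y z → after T x y z ⊎ (U y × V y)} {U x} {V x}
        ⊎-swapʳ ⊎-swapʳ
        (almostFull-×-unary {T = λ y z → after T x y z ⊎ U x} {U} {V}
          (λ { (inj₁ r) → Sum.map₁ (inj₁ ∘ inj₁) (f r)
             ; (inj₂ r) → inj₁ (Sum.map₁ inj₂ (f r)) })
          (Sum.map₁ (inj₁ ∘ inj₁) ∘ g) (p′ x) q)
        (almostFull-×-unary {T = λ y z → after T x y z ⊎ V x} {U} {V}
          (Sum.map₁ (inj₁ ∘ inj₁) ∘ f)
          (λ { (inj₁ r) → Sum.map₁ (inj₁ ∘ inj₁) (g r)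
             ; (inj₂ r) → inj₁ (Sum.map₁ inj₂ (g r)) }) p (q′ x)))

  almostFull-∪-∩ : {P Q T R S : Rel A ℓ} → P ⇒ T ∪ R → Q ⇒ T ∪ S →
    AlmostFull P → AlmostFull Q → AlmostFull (T ∪ (R ∩ S))
  almostFull-∪-∩ f g (now p) q =
    almostFull-mono (λ {x} {y} qxy → [ inj₁ , (λ r → Sum.map₂ (r ,_) (g qxy)) ]′ (f (p x y))) q
  almostFull-∪-∩ f g p@(later _) (now q) =
    almostFull-mono (λ {x} {y} pxy → [ inj₁ , (λ s → Sum.map₂ (_, s) (f pxy)) ]′ (g (q x y))) p
  almostFull-∪-∩ {T = T} {R} {S} f g p@(later p′) q@(later q′) = later λ x →
    almostFull-mono
      (λ { (inj₁ (inj₁ (inj₁ t))) → inj₁ (inj₁ t) ; (inj₁ (inj₁ (inj₂ t))) → inj₂ (inj₁ t)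
         ; (inj₁ (inj₂ rs)) → inj₁ (inj₂ rs) ; (inj₂ rs) → inj₂ (inj₂ rs) })
      (almostFull-×-unary {T = after T x ∪ (R ∩ S)} {R x} {S x}
        ⊎-swapʳ ⊎-swapʳ
        (almostFull-∪-∩ {T = λ y z → after T x y z ⊎ R x y} {R} {S}
          (λ { (inj₁ r) → Sum.map₁ (inj₁ ∘ inj₁) (f r)
             ; (inj₂ r) → inj₁ (Sum.map₁ inj₂ (f r)) })
          (Sum.map₁ (inj₁ ∘ inj₁) ∘ g) (p′ x) q)
        (almostFull-∪-∩ {T = λ y z → after T x y z ⊎ S x y} {R} {S}
          (Sum.map₁ (inj₁ ∘ inj₁) ∘ f)
          (λ { (inj₁ r) → Sum.map₁ (inj₁ ∘ inj₁) (g r)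
             ; (inj₂ r) → inj₁ (Sum.map₁ inj₂ (g r)) }) p (q′ x)))

almostFull-∩ : {R S : Rel A ℓ} → AlmostFull R → AlmostFull S → AlmostFull (R ∩ S)
almostFull-∩ {R = R} {S} r s =
  almostFull-mono (λ { (inj₁ rs) → rs ; (inj₂ rs) → rs })
    (almostFull-∪-∩ {T = R ∩ S} {R} {S} inj₂ inj₂ r s)

almostFull-⋂ : ∀ {n} (R : Fin n → Rel A ℓ) → (∀ i → AlmostFull (R i)) →
  AlmostFull (λ x y → ∀ i → R i x y)
almostFull-⋂ {n = zero}  R r = now λ x y ()
almostFull-⋂ {n = suc n} R r =
  almostFull-mono (λ (r₀ , rs) → ∀-cons r₀ rs)
    (almostFull-∩ (r zero) (almostFull-⋂ (R ∘ suc) (r ∘ suc)))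

-- A new term either is at least the last one, which gives a good pair, or lowers the value to beat,
-- which cannot go on forever.
almostFull-≤ : AlmostFull _≤_
almostFull-≤ = later λ x → after-≤ x ≤-refl
  where
  -- The bound `k` drops by one at each call, which makes the jump to an arbitrary smaller `y`
  -- structural.
  after-≤ : ∀ {k} x → x ≤ k → AlmostFull (after _≤_ x)
  after-≤ zero    _         = now λ _ _ → inj₂ z≤n
  after-≤ (suc x) (s≤s x≤k) = later λ y →
    [ (λ y≤x → almostFull-mono (Sum.map inj₁ inj₁) (after-≤ y (≤-trans y≤x x≤k)))
    , (λ x<y → now λ _ _ → inj₂ (inj₂ x<y)) ]′ (≤-<-connex y x)

goodPair : {R : Rel A ℓ} → AlmostFull R → (f : ℕ → A) →
  ∃[ i ] ∃[ k ] R (f i) (f (i + suc k))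
goodPair (now r)   f = 0 , 0 , r (f 0) (f 1)
goodPair (later r) f with goodPair (r (f 0)) (f ∘ suc)
... | i , k , inj₁ rik = suc i , k , rik
... | i , k , inj₂ r0i = 0 , i , r0i

dickson : ∀ {n} (μ : Fin n → A → ℕ) (f : ℕ → A) →
  ∃[ i ] ∃[ k ] (∀ j → μ j (f i) ≤ μ j (f (i + suc k)))
dickson μ = goodPair (almostFull-⋂ _ λ j → almostFull-on (μ j) almostFull-≤)

-- Min-plus products along a computation

⊓∞-finite : ∀ x y {d} → x ⊓∞ y ≡ [ d ] → x ≡ [ d ] ⊎ y ≡ [ d ]
⊓∞-finite ∞     y     eq   = inj₂ eq
⊓∞-finite [ a ] ∞     eq   = inj₁ eq
⊓∞-finite [ a ] [ b ] refl =
  Sum.map (cong [_] ∘ sym) (cong [_] ∘ sym) (ℤ.⊓-sel a b)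

min-attained : ∀ {n} (v : Fin n → ℤ∞) {d} →
  Vector.foldr _⊓∞_ ∞ v ≡ [ d ] → ∃[ k ] v k ≡ [ d ]
min-attained {suc n} v eq with ⊓∞-finite (v zero) _ eq
... | inj₁ eq₀ = zero , eq₀
... | inj₂ eqs = let k , eqₖ = min-attained (v ∘ suc) eqs in suc k , eqₖ

+∞-finite : ∀ x y {d} → x +∞ y ≡ [ d ] →
  ∃[ a ] ∃[ b ] (x ≡ [ a ] × y ≡ [ b ] × a ℤ.+ b ≡ d)
+∞-finite [ a ] [ b ] refl = a , b , refl , refl , refl

Differences : ∀ {n} → Matrix n → Rel (Vec ℤ n) _
Differences A X Y = ∀ i j d → A i j ≡ [ d ] → lookup Y j ≡ lookup X i ℤ.+ d

-- A finite minimum is attained at some `k` with both summands finite, and the two exact differences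
-- telescope through `lookup Y k`.
⊗-differences : ∀ {n} (A B : Matrix n) (X Y Z : Vec ℤ n) →
  Differences A X Y → Differences B Y Z → Differences (A ⊗ B) X Z
⊗-differences A B X Y Z hA hB i j d eq
  with min-attained (λ k → A i k +∞ B k j) eq
... | k , eqₖ with +∞-finite (A i k) (B k j) eqₖ
... | a , b , eqA , eqB , refl = begin
  lookup Z j                   ≡⟨ hB k j b eqB ⟩
  lookup Y k ℤ.+ b             ≡⟨ cong (ℤ._+ b) (hA i k a eqA) ⟩
  (lookup X i ℤ.+ a) ℤ.+ b     ≡⟨ ℤ.+-assoc (lookup X i) a b ⟩
  lookup X i ℤ.+ (a ℤ.+ b)     ∎
  where open ≡-Reasoning

∣∣-mono-< : ∀ {i j} → 0ℤ ℤ.< i → i ℤ.< j → ∣ i ∣ < ∣ j ∣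
∣∣-mono-< (ℤ.+<+ _) (ℤ.+<+ i<j) = i<j

negative⇒decrease : ∀ {n} (A : Matrix n) (X Y : Vec ℤ n) → HasNegativeDiagonalEntry A →
  Differences A X Y → AllPositive Y → ∃[ i ] ∣ lookup Y i ∣ < ∣ lookup X i ∣
negative⇒decrease A X Y (i , d , eq , d<0) h Y>0 =
  i , ∣∣-mono-< (Y>0 i)
        (subst (ℤ._< lookup X i) (sym (h i i d eq))
          (subst (lookup X i ℤ.+ d ℤ.<_) (ℤ.+-identityʳ (lookup X i))
            (ℤ.+-monoʳ-< (lookup X i) d<0)))

module Computation {n m} (g : Fin m → Vec ℤ (suc n) → Vec ℤ n)
  (C : Fin m → Matrix n) (assoc : ∀ ℓ → Associated (g ℓ) (C ℓ))
  {s : ℕ → Maybe (Vec ℤ n)} (isComp : IsComputation (whileProgram g) s) where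

  open IsComputation isComp

  previous : ∀ t {Y} → s (suc t) ≡ just Y → ∃[ X ] s t ≡ just X
  previous t eq with s t in eqₜ
  ... | just X  = X , refl
  ... | nothing with () ← trans (sym eq) (closed t eqₜ)

  step-differences : ∀ t {X Y} → s t ≡ just X → s (suc t) ≡ just Y →
    ∃[ ℓ ] Differences (C ℓ) X Y
  step-differences t eqX eqY with steps t _ _ eqX eqY
  ... | X>0 , ℓ , u , refl = ℓ , λ i j d eq → assoc ℓ i j d eq _ u X>0

  -- Induction on the length splits off the first step, matching the right-nested bracketing of
  -- `matrixProduct`.
  run-differences : ∀ t k {Y} → s (t + suc k) ≡ just Y →
    ∃[ X ] (s t ≡ just X × ∃[ w ] Differences (matrixProduct C w) X Y)
  run-differences t zero eqY rewrite +-suc t 0 | +-identityʳ t =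
    let X , eqX = previous t eqY
        ℓ , h   = step-differences t eqX eqY
    in X , eqX , ℓ ∷ [] , h
  run-differences t (suc k) {Z} eqZ rewrite +-suc t (suc k) =
    let Y , eqY , (ℓ′ ∷ ℓs) , hs = run-differences (suc t) k eqZ
        X , eqX = previous t eqY
        ℓ , h   = step-differences t eqX eqY
    in X , eqX , ℓ ∷ ℓ′ ∷ ℓs , ⊗-differences (C ℓ) (matrixProduct C (ℓ′ ∷ ℓs)) X Y Z h hs

  -- The default 0 makes the measure total, so Dickson's lemma applies to `s` before it is known
  -- whether `s` is finite.
  μ : Fin n → Maybe (Vec ℤ n) → ℕ
  μ j = maybe (λ X → ∣ lookup X j ∣) 0

  finite : (∀ w → HasNegativeDiagonalEntry (matrixProduct C w)) → Finite s
  finite neg with dickson μ s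
  -- One state beyond the good pair is inspected: if it exists, the later state of the pair
  -- satisfied the loop condition and is positive, so absolute values reflect the decrease.
  ... | t , k , dom with s (suc (t + suc k)) in eqZ
  ... | nothing = suc (t + suc k) , eqZ
  ... | just Z  =
    let Y , eqY         = previous (t + suc k) eqZ
        X , eqX , w , h = run-differences t k eqY
        Y>0             = proj₁ (steps (t + suc k) Y Z eqY eqZ)
        i , Yᵢ<Xᵢ       = negative⇒decrease (matrixProduct C w) X Y (neg w) h Y>0
    in ⊥-elim (<⇒≱ Yᵢ<Xᵢ (subst₂ _≤_ (cong (μ i) eqX) (cong (μ i) eqY) (dom i)))

theorem8p3 : (n m : ℕ) → 1 ≤ n → 1 ≤ m →
    (g : Fin m → Vec ℤ (suc n) → Vec ℤ n) →
    (∀ ℓ → Computable (g ℓ)) →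
    (C : Fin m → Matrix n) →
    (∀ ℓ → Associated (g ℓ) (C ℓ)) →
    (∀ (w : List⁺ (Fin m)) → HasNegativeDiagonalEntry (matrixProduct C w)) →
    Terminates (whileProgram g)
theorem8p3 n m _ _ g _ C assoc neg s isComp = Computation.finite g C assoc isComp neg
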